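{- Let $\Bbbk^\bullet$ be a set of forcing commands closed under anti-$\to_\bullet$-evaluation, $\mathcal D^{\oplus\bullet}$ a positive propositional domain (for the countdown interpretation, containing all sets $\|\mathcal C[p]\|^\bullet$) and $\rho^\bullet$ a total valuation. For every MAL formula $C$, every closed term $t$ and every $p\in\mathbb N$, $$t\Vdash^\bullet(\mathbf p\Vdash_fC)\iff(t,p)\Vdash^\circ C,$$ where $\Vdash^\bullet$ is countdown-machine realizability, $\Vdash_f$ is the linear forcing translation, and $\Vdash^\circ$ is the quantitative realizability over the monoid $\mathbb N$ with the pole $\Bbbk^\circ$ and valuation $\rho^\circ$ induced by $\Bbbk^\bullet$ and $\rho^\bullet$.
   Context: **Terms.** Positive variables $x,\dots$, negative variables $\alpha,\dots$, $\kappa,\kappa'$ of either polarity. Positive values $V_+::=x\mid (V,V')\mid\{V\}\mid\overline n\ (n\in\mathbb N)\mid k_+$ (other constants); values $V::=V_+\mid t_-$; positive terms $t_+::=V_+\mid\mu\alpha.c$; negative terms $t_-::=\alpha\mid\mu(\kappa,\kappa').c\ (\kappa\neq\kappa')\mid\mu\{\kappa\}.c\mid\mu x.c\mid k_-$; commands $c::=\langle t_+|t_-\rangle$ with $\langle t|u\rangle$ and $\langle u|t\rangle$ identified. Pairs/one-tuples $(t,u)$, $\{t\}$ of non-values, should they occur, are abbreviations for $\mu\alpha.\langle t|\mu\kappa.\langle u|\mu\kappa'.\langle(\kappa,\kappa')|\alpha\rangle\rangle\rangle$, $\mu\alpha.\langle t|\mu\kappa.\langle\{\kappa\}|\alpha\rangle\rangle$.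 **Countdown machine.** A negative command is $\langle t^\ominus|u_+\rangle$ with $t$ a term of either polarity and $u_+$ a positive term ($\ominus$ is just a mark). A forcing command is a negative command $\langle t^\ominus|(u,K)\rangle$, also written $\langle t^\ominus|u\rangle\{K\}$, where $K$ is a term and $t,u$ are terms of opposite polarities; $\langle t^\ominus|u\rangle\{K\}$ and $\langle u^\ominus|t\rangle\{K\}$ are identified. For a command $c=\langle t_+|u_-\rangle$, $c^\bullet\{K\}=\langle u_-^\ominus|(t_+,K)\rangle$. Reduction $\to_\bullet$: $\langle t_-^\ominus|\mu\alpha.c\rangle\{\overline n\}\to_\bullet(c[t_-/\alpha])^\bullet\{\overline n\}$; $\langle(\mu x.c)^\ominus|V_+\rangle\{\overline n\}\to_\bullet(c[V_+/x])^\bullet\{\overline n\}$; $\langle(\mu(\kappa,\kappa').c)^\ominus|(V_1,V_2)\rangle\{\overline{n+1}\}\to_\bullet(c[V_1/\kappa,V_2/\kappa'])^\bullet\{\overline n\}$; $\langle(\mu\{\kappa\}.c)^\ominus|\{V\}\rangle\{\overline{n+1}\}\to_\bullet(c[V/\kappa])^\bullet\{\overline n\}$; the last two redexes with counter $\overline0$ diverge. Closed under anti-evaluation: $c\to_\bullet c'$ and $c'\in\Bbbk^\bullet$ imply $c\in\Bbbk^\bullet$. **Countdown interpretation.** Let $\Bbbk^\bullet_0=\{\langle t_+|u_-\rangle:\langle u_-^\ominus|t_+\rangle\in\Bbbk^\bullet\}$. Closed terms $t_+$ (positive) and $u_-$ (negative) are orthogonal if $\langle t_+|u_-\rangle\in\Bbbk^\bullet_0$;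 for a set $X$ of closed terms of one polarity, $X^\bot$ is the set of closed terms of the other polarity orthogonal to all elements of $X$. $X\otimes Y=\{(t,u):t\in X,u\in Y\}$, $\downarrow X=\{\{t\}:t\in X\}$. A positive propositional domain $\mathcal D^{\oplus\bullet}$ is a set of sets of closed positive values, closed under unions and intersections of families and such that $X\otimes Y,\downarrow X\in\mathcal D^{\oplus\bullet}$ for all $X,Y\in\mathcal D^{\oplus\bullet}\cup\{Z^\bot:Z\in\mathcal D^{\oplus\bullet}\}$; it is assumed to contain each set $\|\mathcal C[p]\|^\bullet=\{\overline n:n\in\mathbb N,\ p\le n\}$, $p\in\mathbb N$, which interprets a positive predicate constant $\mathcal C[\cdot]:\iota\to o^+$ ($\iota$ is the kind of natural numbers, $o^\pm$ the kinds of positive/negative formulas). A total valuation $\rho^\bullet$ assigns in particular to each variable $X^{\iota\to o^+}$ a function $\mathbb N\to\mathcal D^{\oplus\bullet}$. Formulas are interpreted by: $\|A\otimes B\|^\bullet=\|A\|^\bullet\otimes\|B\|^\bullet$; $\|\downarrow A\|^\bullet=\downarrow\|A\|^\bullet$; $\|\exists r.A\|^\bullet=\bigcup_{r\in\mathbb N}\|A\|^\bullet$ for $A$ positive. The equational implication $\langle T=U\rangle A$ (informally "$T\cong U$ implies $A$", of the same polarity as $A$) is interpreted as $A$ is if $T\cong U$ (i.e. $T$ and $U$ are convertible: they denote the same number), and by $\emptyset^\bot$ (all closed terms of the polarity of $A$) otherwise. A negative formula $N$ (built with $\wp,\uparrow,\forall$) is interpreted by orthogonality: $t\in\|N\|^\bullet$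 iff $\langle t^\ominus|u\rangle\in\Bbbk^\bullet$ for every $u\in\|N^\bot\|^\bullet$, where $t$ is a closed term that need not be negative. Realizability: $t\Vdash^\bullet A$ means $t\in\|A\|^\bullet_{\rho^\bullet}$. **MAL and forcing translation.** MAL formulas: $A,B::=P\mid N$; positive $P::=X\mid A\otimes B\mid\downarrow A$; negative $N::=X^\bot\mid A\wp B\mid\uparrow A$, with the usual De Morgan involutive negation ($\otimes/\wp$, $\downarrow/\uparrow$, $X/X^\bot$). For a predicate $Z$ on $\iota$, its forcing orthogonal is $\overline Z=\lambda r.\forall r'.\,Z(r')\multimap\mathcal C[r+r']^\bot$, with $A\multimap B=A^\bot\wp B$; thus $\|\overline Z(\mathbf p)\|^\bullet$ is the set of closed $t$ such that $\langle t^\ominus|(u,K)\rangle\in\Bbbk^\bullet$ for all $r\in\mathbb N$, $u\in\|Z(\mathbf r)\|^\bullet$, $K\in\|\mathcal C[p+r]\|^\bullet$. The translation: $X^*=X^{\iota\to o^+}$; $(X^\bot)^*=\overline{X^{\iota\to o^+}}$; $(A\otimes B)^*=\lambda r.\exists p_1.\exists p_2.\langle r=p_1+p_2\rangle(A^*(p_1)\otimes B^*(p_2))$; $(A\wp B)^*=\overline{\lambda r.\exists p_1.\exists p_2.\langle r=p_1+p_2\rangle((A^\bot)^*(p_1)\otimes(B^\bot)^*(p_2))}$; $(\downarrow A)^*=\lambda r.\downarrow A^*(r)$; $(\uparrow A)^*=\overline{\lambda r.\downarrow(A^\bot)^*(r)}$. The forcing relation is the negative formula $p\Vdash_fP\equiv\overline{\overline{P^*}}(p)$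 for $P$ positive and $p\Vdash_fN\equiv N^*(p)$ for $N$ negative. $\mathbf p$ is the numeral of $p$. **Induced quantitative realizability.** $\Bbbk^\circ=\{(c,p):c\text{ closed command},\ p\in\mathbb N,\ \forall K\in\|\mathcal C[p]\|^\bullet,\ c^\bullet\{K\}\in\Bbbk^\bullet\}$; $\rho^\circ(X)=\{(t,p):t\in\rho^\bullet(X^{\iota\to o^+})(p)\}$. A closed positive weighted term $(t_+,p)$ and a closed negative weighted term $(t_-,q)$ ($p,q\in\mathbb N$) are orthogonal if $(\langle t_+|t_-\rangle,p+q)\in\Bbbk^\circ$; for a set $X$ of positive (resp. negative) weighted terms, $X^\bot$ is the set of negative (resp. positive) weighted terms orthogonal to every element of $X$. $\|X\|^\circ=\rho^\circ(X)$; $\|X^\bot\|^\circ=\rho^\circ(X)^\bot$; $\|A\otimes B\|^\circ=\{((t,u),p+q):(t,p)\in\|A\|^\circ,(u,q)\in\|B\|^\circ\}$; $\|\downarrow A\|^\circ=\{(\{t\},p):(t,p)\in\|A\|^\circ\}$; $\|A\wp B\|^\circ=(\|A^\bot\otimes B^\bot\|^\circ)^\bot$; $\|\uparrow A\|^\circ=(\|\downarrow A^\bot\|^\circ)^\bot$. $(t,p)\Vdash^\circ C$ means $(t,p)\in\|C\|^\circ_{\rho^\circ}$.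
   Formalization: As worded the claim fails; here a positive ⟨T=U⟩A with T≇U is interpreted by ∅ (not all closed terms), (t,p)⊩°P for positive P means membership in the biorthogonal of ‖P‖°, and t and the components of formulas are terms of the polarity of their formula. -}

module Defs where

open import Level using (0ℓ) renaming (suc to lsuc)
open import Data.Fin using (Fin; zero; suc)
open import Data.List using (List; []; _∷_)
open import Data.List.Membership.Propositional using (_∈_)
open import Data.List.Relation.Binary.Subset.Propositional
  using () renaming (_⊆_ to _⊆ᴸ_)
open import Data.List.Relation.Binary.Subset.Propositional.Properties using (∷⁺ʳ)
open import Data.List.Relation.Unary.Any using (here; there)
open import Data.Maybe using (Maybe; just; nothing)
open import Data.Nat using (ℕ; suc; _+_; _≤_; z≤n; s≤s)
open import Data.Nat.Properties using (≤-refl; m+n≤o⇒m≤o; m+n≤o⇒n≤o)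
open import Data.Product using (∃; ∃₂; _×_; _,_)
open import Data.Vec using (Vec; []; _∷_; lookup)
open import Function using (_∘_)
open import Function.Bundles using (_⇔_)
open import Relation.Binary.PropositionalEquality using (_≡_; refl; cong; cong₂; subst; sym)
open import Relation.Unary using (Pred; _⊆_; _≐_)

data Pol : Set where
  pos neg : Pol

opp : Pol → Pol
opp pos = neg
opp neg = pos

data MAL : Pol → Set where
  var  : ℕ → MAL pos
  _⊗_  : ∀ {ε ε′} → MAL ε → MAL ε′ → MAL pos
  ↓_   : ∀ {ε} → MAL ε → MAL pos
  var⊥ : ℕ → MAL neg
  _⅋_  : ∀ {ε ε′} → MAL ε → MAL ε′ → MAL neg
  ↑_   : ∀ {ε} → MAL ε → MAL neg

infixr 7 _⊗_ _⅋_
infix  8 ↓_ ↑_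
infix  9 _ᗮ

_ᗮ : ∀ {ε} → MAL ε → MAL (opp ε)
(var X) ᗮ  = var⊥ X
(A ⊗ B) ᗮ  = (A ᗮ) ⅋ (B ᗮ)
(↓ A) ᗮ    = ↑ (A ᗮ)
(var⊥ X) ᗮ = var X
(A ⅋ B) ᗮ  = (A ᗮ) ⊗ (B ᗮ)
(↑ A) ᗮ    = ↓ (A ᗮ)

size : ∀ {ε} → MAL ε → ℕ
size (var X)  = 1
size (A ⊗ B)  = suc (size A + size B)
size (↓ A)    = suc (size A)
size (var⊥ X) = 1
size (A ⅋ B)  = suc (size A + size B)
size (↑ A)    = suc (size A)

size-ᗮ : ∀ {ε} (A : MAL ε) → size (A ᗮ) ≡ size A
size-ᗮ (var X)  = refl
size-ᗮ (A ⊗ B)  = cong₂ (λ a b → suc (a + b)) (size-ᗮ A) (size-ᗮ B)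
size-ᗮ (↓ A)    = cong suc (size-ᗮ A)
size-ᗮ (var⊥ X) = refl
size-ᗮ (A ⅋ B)  = cong₂ (λ a b → suc (a + b)) (size-ᗮ A) (size-ᗮ B)
size-ᗮ (↑ A)    = cong suc (size-ᗮ A)

-- Expressions of kind ι with n free variables.
data Num (n : ℕ) : Set where
  idx : Fin n → Num n
  lit : ℕ → Num n
  _⊹_ : Num n → Num n → Num n

eval : ∀ {n} → Num n → Vec ℕ n → ℕ
eval (idx i) e = lookup e i
eval (lit k) e = k
eval (T ⊹ U) e = eval T e + eval U e

-- `var X T` is X(T) for the variable X of kind ι → o⁺; the MAL variable X and
-- this variable share the same name.
data Form (n : ℕ) : Pol → Set where
  var    : ℕ → Num n → Form n pos
  𝒞[_]   : Num n → Form n pos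
  _⊗_    : ∀ {ε ε′} → Form n ε → Form n ε′ → Form n pos
  ↓_     : ∀ {ε} → Form n ε → Form n pos
  ∃ι_    : Form (suc n) pos → Form n pos
  var⊥   : ℕ → Num n → Form n neg
  𝒞⊥[_]  : Num n → Form n neg
  _⅋_    : ∀ {ε ε′} → Form n ε → Form n ε′ → Form n neg
  ↑_     : ∀ {ε} → Form n ε → Form n neg
  ∀ι_    : Form (suc n) neg → Form n neg
  ⟨_≐_⟩_ : ∀ {ε} → Num n → Num n → Form n ε → Form n ε

infix 6 ∃ι_ ∀ι_ ⟨_≐_⟩_

dual : ∀ {n ε} → Form n ε → Form n (opp ε)
dual (var X T)       = var⊥ X T
dual 𝒞[ T ]          = 𝒞⊥[ T ]
dual (A ⊗ B)         = dual A ⅋ dual B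
dual (↓ A)           = ↑ dual A
dual (∃ι A)          = ∀ι dual A
dual (var⊥ X T)      = var X T
dual 𝒞⊥[ T ]         = 𝒞[ T ]
dual (A ⅋ B)         = dual A ⊗ dual B
dual (↑ A)           = ↓ dual A
dual (∀ι A)          = ∃ι dual A
dual (⟨ T ≐ U ⟩ A)   = ⟨ T ≐ U ⟩ dual A

infixr 7 _⊸_

_⊸_ : ∀ {n ε ε′} → Form n ε → Form n ε′ → Form n neg
A ⊸ B = dual A ⅋ B

sizeᶠ : ∀ {n ε} → Form n ε → ℕ
sizeᶠ (var X T)     = 1
sizeᶠ 𝒞[ T ]        = 1
sizeᶠ (A ⊗ B)       = suc (sizeᶠ A + sizeᶠ B)
sizeᶠ (↓ A)         = suc (sizeᶠ A)
sizeᶠ (∃ι A)        = suc (sizeᶠ A)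
sizeᶠ (var⊥ X T)    = 1
sizeᶠ 𝒞⊥[ T ]       = 1
sizeᶠ (A ⅋ B)       = suc (sizeᶠ A + sizeᶠ B)
sizeᶠ (↑ A)         = suc (sizeᶠ A)
sizeᶠ (∀ι A)        = suc (sizeᶠ A)
sizeᶠ (⟨ T ≐ U ⟩ A) = suc (sizeᶠ A)

size-dual : ∀ {n ε} (A : Form n ε) → sizeᶠ (dual A) ≡ sizeᶠ A
size-dual (var X T)     = refl
size-dual 𝒞[ T ]        = refl
size-dual (A ⊗ B)       = cong₂ (λ a b → suc (a + b)) (size-dual A) (size-dual B)
size-dual (↓ A)         = cong suc (size-dual A)
size-dual (∃ι A)        = cong suc (size-dual A)
size-dual (var⊥ X T)    = refl
size-dual 𝒞⊥[ T ]       = refl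
size-dual (A ⅋ B)       = cong₂ (λ a b → suc (a + b)) (size-dual A) (size-dual B)
size-dual (↑ A)         = cong suc (size-dual A)
size-dual (∀ι A)        = cong suc (size-dual A)
size-dual (⟨ T ≐ U ⟩ A) = cong suc (size-dual A)

substᴺ : ∀ {n m} → (Fin n → Num m) → Num n → Num m
substᴺ σ (idx i) = σ i
substᴺ σ (lit k) = lit k
substᴺ σ (T ⊹ U) = substᴺ σ T ⊹ substᴺ σ U

lift : ∀ {n m} → (Fin n → Num m) → Fin (suc n) → Num (suc m)
lift σ zero    = idx zero
lift σ (suc i) = substᴺ (idx ∘ suc) (σ i)

substᶠ : ∀ {n m ε} → (Fin n → Num m) → Form n ε → Form m ε
substᶠ σ (var X T)     = var X (substᴺ σ T)
substᶠ σ 𝒞[ T ]        = 𝒞[ substᴺ σ T ]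
substᶠ σ (A ⊗ B)       = substᶠ σ A ⊗ substᶠ σ B
substᶠ σ (↓ A)         = ↓ substᶠ σ A
substᶠ σ (∃ι A)        = ∃ι substᶠ (lift σ) A
substᶠ σ (var⊥ X T)    = var⊥ X (substᴺ σ T)
substᶠ σ 𝒞⊥[ T ]       = 𝒞⊥[ substᴺ σ T ]
substᶠ σ (A ⅋ B)       = substᶠ σ A ⅋ substᶠ σ B
substᶠ σ (↑ A)         = ↑ substᶠ σ A
substᶠ σ (∀ι A)        = ∀ι substᶠ (lift σ) A
substᶠ σ (⟨ T ≐ U ⟩ A) = ⟨ substᴺ σ T ≐ substᴺ σ U ⟩ substᶠ σ A

-- A closed predicate λr.A on ι is a formula whose only free variable is r.
Predicate : Pol → Set
Predicate ε = Form 1 ε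

infix 9 _·_

_·_ : ∀ {n ε} → Predicate ε → Num n → Form n ε
Z · T = substᶠ (λ _ → T) Z

-- λr. ∀r′. Z(r′) ⊸ 𝒞[r + r′]^⊥
overline : ∀ {ε} → Predicate ε → Predicate neg
overline Z = let r′ = idx zero ; r = idx (suc zero) in
  ∀ι (Z · r′ ⊸ 𝒞⊥[ r ⊹ r′ ])

-- λr. ∃p₁. ∃p₂. ⟨r = p₁ + p₂⟩ (Y(p₁) ⊗ Z(p₂))
split : ∀ {ε ε′} → Predicate ε → Predicate ε′ → Predicate pos
split Y Z = let p₂ = idx zero ; p₁ = idx (suc zero) ; r = idx (suc (suc zero)) in
  ∃ι ∃ι ⟨ r ≐ p₁ ⊹ p₂ ⟩ (Y · p₁ ⊗ Z · p₂)

-- The clauses for ⅋ and ↑ recur on duals, so the recursion is on a bound m of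
-- the size of the formula.
star≤ : ∀ {m ε} (A : MAL ε) → size A ≤ m → Predicate ε
star≤ (var X)  _       = var X (idx zero)
star≤ (A ⊗ B)  (s≤s h) = split (star≤ A (m+n≤o⇒m≤o (size A) h))
                               (star≤ B (m+n≤o⇒n≤o (size A) h))
star≤ (↓ A)    (s≤s h) = ↓ star≤ A h
star≤ (var⊥ X) _       = overline (var X (idx zero))
star≤ (A ⅋ B)  (s≤s h) = overline
  (split (star≤ (A ᗮ) (subst (_≤ _) (sym (size-ᗮ A)) (m+n≤o⇒m≤o (size A) h)))
         (star≤ (B ᗮ) (subst (_≤ _) (sym (size-ᗮ B)) (m+n≤o⇒n≤o (size A) h))))
star≤ (↑ A)    (s≤s h) = overline
  (↓ star≤ (A ᗮ) (subst (_≤ _) (sym (size-ᗮ A)) h))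

_* : ∀ {ε} → MAL ε → Predicate ε
A * = star≤ A ≤-refl

infix 5 _⊩ᶠ_

_⊩ᶠ_ : ∀ {ε} → ℕ → MAL ε → Form 0 neg
_⊩ᶠ_ {pos} p P = overline (overline (P *)) · lit p
_⊩ᶠ_ {neg} p N = (N *) · lit p

module Calculus (Const : Pol → Set) where

  Ctx : Set
  Ctx = List Pol

  -- Every negative term is a value, hence the constructor `neg`.
  mutual
    data Value (Γ : Ctx) : Pol → Set where
      var  : pos ∈ Γ → Value Γ pos
      pair : ∀ {ε ε′} → Value Γ ε → Value Γ ε′ → Value Γ pos
      box  : ∀ {ε} → Value Γ ε → Value Γ pos
      num  : ℕ → Value Γ pos
      con  : Const pos → Value Γ pos
      neg  : Term Γ neg → Value Γ neg

    -- The last variable bound is the first of the context: in `μpair c`,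
    -- standing for μ(κ,κ′).c, the variable κ′ comes first.
    data Term (Γ : Ctx) : Pol → Set where
      val   : Value Γ pos → Term Γ pos
      μ⁻    : Command (neg ∷ Γ) → Term Γ pos
      covar : neg ∈ Γ → Term Γ neg
      μpair : ∀ {ε ε′} → Command (ε′ ∷ ε ∷ Γ) → Term Γ neg
      μbox  : ∀ {ε} → Command (ε ∷ Γ) → Term Γ neg
      μ⁺    : Command (pos ∷ Γ) → Term Γ neg
      con   : Const neg → Term Γ neg

    data Command (Γ : Ctx) : Set where
      ⟨_∣_⟩ : Term Γ pos → Term Γ neg → Command Γ

  data IsValue {Γ : Ctx} : Term Γ pos → Set where
    val : (V : Value Γ pos) → IsValue (val V)

  mutual
    renV : ∀ {Γ Δ ε} → Γ ⊆ᴸ Δ → Value Γ ε → Value Δ ε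
    renV s (var x)    = var (s x)
    renV s (pair V W) = pair (renV s V) (renV s W)
    renV s (box V)    = box (renV s V)
    renV s (num n)    = num n
    renV s (con k)    = con k
    renV s (neg t)    = neg (ren s t)

    ren : ∀ {Γ Δ ε} → Γ ⊆ᴸ Δ → Term Γ ε → Term Δ ε
    ren s (val V)            = val (renV s V)
    ren s (μ⁻ c)             = μ⁻ (renC (∷⁺ʳ neg s) c)
    ren s (covar α)          = covar (s α)
    ren s (μpair {ε} {ε′} c) = μpair (renC (∷⁺ʳ ε′ (∷⁺ʳ ε s)) c)
    ren s (μbox {ε} c)       = μbox (renC (∷⁺ʳ ε s) c)
    ren s (μ⁺ c)             = μ⁺ (renC (∷⁺ʳ pos s) c)
    ren s (con k)            = con k

    renC : ∀ {Γ Δ} → Γ ⊆ᴸ Δ → Command Γ → Command Δ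
    renC s ⟨ t ∣ u ⟩ = ⟨ ren s t ∣ ren s u ⟩

  wk : ∀ {Γ ε ε′} → Term Γ ε → Term (ε′ ∷ Γ) ε
  wk = ren there

  variableV : ∀ {Γ} ε → ε ∈ Γ → Value Γ ε
  variableV pos x = var x
  variableV neg α = neg (covar α)

  Subst : Ctx → Ctx → Set
  Subst Γ Δ = ∀ {ε} → ε ∈ Γ → Value Δ ε

  none : Subst [] []
  none ()

  infixr 5 _∷ˢ_

  _∷ˢ_ : ∀ {Γ Δ ε} → Value Δ ε → Subst Γ Δ → Subst (ε ∷ Γ) Δ
  (V ∷ˢ σ) (here refl) = V
  (V ∷ˢ σ) (there x)   = σ x

  liftˢ : ∀ {Γ Δ} ε → Subst Γ Δ → Subst (ε ∷ Γ) (ε ∷ Δ)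
  liftˢ ε σ = variableV ε (here refl) ∷ˢ (renV there ∘ σ)

  mutual
    subV : ∀ {Γ Δ ε} → Subst Γ Δ → Value Γ ε → Value Δ ε
    subV σ (var x)    = σ x
    subV σ (pair V W) = pair (subV σ V) (subV σ W)
    subV σ (box V)    = box (subV σ V)
    subV σ (num n)    = num n
    subV σ (con k)    = con k
    subV σ (neg t)    = neg (sub σ t)

    sub : ∀ {Γ Δ ε} → Subst Γ Δ → Term Γ ε → Term Δ ε
    sub σ (val V)            = val (subV σ V)
    sub σ (μ⁻ c)             = μ⁻ (subC (liftˢ neg σ) c)
    sub σ (covar α) with σ α
    ... | neg t              = t
    sub σ (μpair {ε} {ε′} c) = μpair (subC (liftˢ ε′ (liftˢ ε σ)) c)
    sub σ (μbox {ε} c)       = μbox (subC (liftˢ ε σ) c)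
    sub σ (μ⁺ c)             = μ⁺ (subC (liftˢ pos σ) c)
    sub σ (con k)            = con k

    subC : ∀ {Γ Δ} → Subst Γ Δ → Command Γ → Command Δ
    subC σ ⟨ t ∣ u ⟩ = ⟨ sub σ t ∣ sub σ u ⟩

  cut : ∀ {Γ} ε → Term Γ ε → Term Γ (opp ε) → Command Γ
  cut pos t u = ⟨ t ∣ u ⟩
  cut neg u t = ⟨ t ∣ u ⟩

  μ : ∀ {Γ} ε → Command (ε ∷ Γ) → Term Γ (opp ε)
  μ pos c = μ⁺ c
  μ neg c = μ⁻ c

  asValue : ∀ {Γ ε} → Term Γ ε → Maybe (Value Γ ε)
  asValue {ε = pos} (val V) = just V
  asValue {ε = pos} (μ⁻ c)  = nothing
  asValue {ε = neg} t       = just (neg t)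

  -- (t , u) and {t} for arbitrary terms: a value if the components are values,
  -- the abbreviations
  --   μα.⟨t|μκ.⟨u|μκ′.⟨(κ,κ′)|α⟩⟩⟩   and   μα.⟨t|μκ.⟨{κ}|α⟩⟩
  -- otherwise.
  ⟪_,_⟫ : ∀ {Γ ε ε′} → Term Γ ε → Term Γ ε′ → Term Γ pos
  ⟪_,_⟫ {ε = ε} {ε′} t u with asValue t | asValue u
  ... | just V | just W = val (pair V W)
  ... | _      | _      =
    μ⁻ (cut ε (wk t) (μ ε (cut ε′ (wk (wk u)) (μ ε′
      ⟨ val (pair (variableV ε (there (here refl))) (variableV ε′ (here refl)))
      ∣ covar (there (there (here refl))) ⟩))))

  box⟪_⟫ : ∀ {Γ ε} → Term Γ ε → Term Γ pos
  box⟪_⟫ {ε = ε} t with asValue t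
  ... | just V  = val (box V)
  ... | nothing =
    μ⁻ (cut ε (wk t) (μ ε
      ⟨ val (box (variableV ε (here refl))) ∣ covar (there (here refl)) ⟩))

  record NegCommand : Set where
    constructor ⟨_⊖∣_⟩
    field
      {pol} : Pol
      left  : Term [] pol
      right : Term [] pos

  ⟨_⊖∣_⟩[_] : ∀ {ε ε′} → Term [] ε → Term [] (opp ε) → Term [] ε′ → NegCommand
  ⟨ t ⊖∣ u ⟩[ K ] = ⟨ t ⊖∣ ⟪ u , K ⟫ ⟩

  data IsForcing : NegCommand → Set where
    forcing : ∀ {ε ε′} (t : Term [] ε) (u : Term [] (opp ε)) (K : Term [] ε′) →
              IsForcing ⟨ t ⊖∣ u ⟩[ K ]

  _•[_] : ∀ {ε} → Command [] → Term [] ε → NegCommand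
  ⟨ t ∣ u ⟩ •[ K ] = ⟨ u ⊖∣ t ⟩[ K ]

  numeral : ℕ → Term [] pos
  numeral n = val (num n)

  infix 4 _→•_

  data _→•_ : NegCommand → NegCommand → Set where
    →μ⁻    : ∀ {t : Term [] neg} {c n} →
             ⟨ t ⊖∣ μ⁻ c ⟩[ numeral n ] →• subC (neg t ∷ˢ none) c •[ numeral n ]
    →μ⁺    : ∀ {c} {V : Value [] pos} {n} →
             ⟨ μ⁺ c ⊖∣ val V ⟩[ numeral n ] →• subC (V ∷ˢ none) c •[ numeral n ]
    →μpair : ∀ {ε ε′ c} {V : Value [] ε} {W : Value [] ε′} {n} →
             ⟨ μpair c ⊖∣ val (pair V W) ⟩[ numeral (suc n) ]
               →• subC (W ∷ˢ V ∷ˢ none) c •[ numeral n ]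
    →μbox  : ∀ {ε c} {V : Value [] ε} {n} →
             ⟨ μbox c ⊖∣ val (box V) ⟩[ numeral (suc n) ]
               →• subC (V ∷ˢ none) c •[ numeral n ]

  -- 𝕜•.  Commands ⟨t⊖|u⟩{K} and ⟨u⊖|t⟩{K} are identified, so a set of forcing
  -- commands is a predicate invariant under exchanging t and u.
  record Pole : Set₁ where
    field
      _∈𝕜       : NegCommand → Set
      isForcing : ∀ {c} → c ∈𝕜 → IsForcing c
      exchange  : ∀ {ε} {t : Term [] pos} {u : Term [] neg} {K : Term [] ε} →
                  ⟨ t ⊖∣ u ⟩[ K ] ∈𝕜 ⇔ ⟨ u ⊖∣ t ⟩[ K ] ∈𝕜
      anti-eval : ∀ {c c′} → c →• c′ → c′ ∈𝕜 → c ∈𝕜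

  Terms : Pol → Set₁
  Terms ε = Pred (Term [] ε) 0ℓ

  infixr 7 _⊗ˢ_
  infix  8 ↓ˢ_

  _⊗ˢ_ : ∀ {ε ε′} → Terms ε → Terms ε′ → Terms pos
  (X ⊗ˢ Y) s = ∃₂ λ t u → X t × Y u × s ≡ ⟪ t , u ⟫

  ↓ˢ_ : ∀ {ε} → Terms ε → Terms pos
  (↓ˢ X) s = ∃ λ t → X t × s ≡ box⟪ t ⟫

  ‖𝒞[_]‖ : ℕ → Terms pos
  ‖𝒞[ p ]‖ t = ∃ λ n → p ≤ n × t ≡ numeral n

  module _ (𝕜• : Pole) where
    open Pole 𝕜•

    𝕜•₀ : Pred (Command []) 0ℓ
    𝕜•₀ ⟨ t ∣ u ⟩ = ⟨ u ⊖∣ t ⟩ ∈𝕜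

    _^⊥ : ∀ {ε} → Terms ε → Terms (opp ε)
    _^⊥ {ε} X u = ∀ t → X t → 𝕜•₀ (cut ε t u)

    data Component (D : Pred (Terms pos) (lsuc 0ℓ)) : ∀ {ε} → Terms ε → Set₁ where
      pos : ∀ {Z} → D Z → Component D Z
      neg : ∀ {Z} → D Z → Component D (Z ^⊥)

    -- Intersections are taken within the set of closed positive values; this
    -- matters only for the empty family.
    record PositiveDomain : Set₂ where
      field
        _∈𝒟    : Pred (Terms pos) (lsuc 0ℓ)
        respects : ∀ {X Y} → X ≐ Y → X ∈𝒟 → Y ∈𝒟
        values   : ∀ {X} → X ∈𝒟 → X ⊆ IsValue
        ⋃-closed : (I : Set) (F : I → Terms pos) → (∀ i → F i ∈𝒟) →
                   (λ t → ∃ λ i → F i t) ∈𝒟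
        ⋂-closed : (I : Set) (F : I → Terms pos) → (∀ i → F i ∈𝒟) →
                   (λ t → IsValue t × (∀ i → F i t)) ∈𝒟
        ⊗-closed : ∀ {ε ε′} {X : Terms ε} {Y : Terms ε′} →
                   Component _∈𝒟 X → Component _∈𝒟 Y → (X ⊗ˢ Y) ∈𝒟
        ↓-closed : ∀ {ε} {X : Terms ε} → Component _∈𝒟 X → (↓ˢ X) ∈𝒟
        𝒞-closed : ∀ p → ‖𝒞[ p ]‖ ∈𝒟

    record Valuation (𝒟 : PositiveDomain) : Set₁ where
      open PositiveDomain 𝒟
      field
        ⟦_⟧    : ℕ → ℕ → Terms pos
        member : ∀ X n → ⟦ X ⟧ n ∈𝒟

  module Countdown (𝕜• : Pole) (ρ : ℕ → ℕ → Terms pos) where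
    open Pole 𝕜•

    -- A positive ⟨T = U⟩A is empty when T and U differ, so that its dual is
    -- interpreted by ∅^⊥.  It occurs under ∃ in the translation of ⊗, where any
    -- larger value would absorb the union over all splittings.
    mutual
      ‖_‖⁺≤ : ∀ {n m} (P : Form n pos) → sizeᶠ P ≤ m → Vec ℕ n → Terms pos
      ‖ var X T ‖⁺≤ _ e           = ρ X (eval T e)
      ‖ 𝒞[ T ] ‖⁺≤ _ e            = ‖𝒞[ eval T e ]‖
      ‖ A ⊗ B ‖⁺≤ (s≤s h) e       = ‖ A ‖≤ (m+n≤o⇒m≤o (sizeᶠ A) h) e
                                    ⊗ˢ ‖ B ‖≤ (m+n≤o⇒n≤o (sizeᶠ A) h) e
      ‖ ↓ A ‖⁺≤ (s≤s h) e         = ↓ˢ ‖ A ‖≤ h e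
      ‖ ∃ι A ‖⁺≤ (s≤s h) e        = λ t → ∃ λ r → ‖ A ‖⁺≤ h (r ∷ e) t
      ‖ ⟨ T ≐ U ⟩ A ‖⁺≤ (s≤s h) e = λ t → eval T e ≡ eval U e × ‖ A ‖⁺≤ h e t

      ‖_‖≤ : ∀ {n m ε} (A : Form n ε) → sizeᶠ A ≤ m → Vec ℕ n → Terms ε
      ‖_‖≤ {ε = pos} P h e   = ‖ P ‖⁺≤ h e
      ‖_‖≤ {ε = neg} N h e t =
        ∀ u → ‖ dual N ‖⁺≤ (subst (_≤ _) (sym (size-dual N)) h) e u → ⟨ t ⊖∣ u ⟩ ∈𝕜

    ‖_‖ : ∀ {ε} → Form 0 ε → Terms ε
    ‖ A ‖ = ‖ A ‖≤ ≤-refl []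

    infix 4 _⊩•_

    -- Realizability of a negative formula by a term of either polarity.
    _⊩•_ : ∀ {ε} → Term [] ε → Form 0 neg → Set
    t ⊩• N = ∀ u → ‖ dual N ‖ u → ⟨ t ⊖∣ u ⟩ ∈𝕜

  Weighted : Pol → Set
  Weighted ε = Term [] ε × ℕ

  module Quantitative (𝕜° : Pred (Command [] × ℕ) 0ℓ)
                      (ρ° : ℕ → Pred (Weighted pos) 0ℓ) where

    _⊥°_ : Weighted pos → Weighted neg → Set
    (t , p) ⊥° (u , q) = 𝕜° (⟨ t ∣ u ⟩ , p + q)

    _^⊥° : ∀ {ε} → Pred (Weighted ε) 0ℓ → Pred (Weighted (opp ε)) 0ℓ
    _^⊥° {pos} X b = ∀ a → X a → a ⊥° b
    _^⊥° {neg} X a = ∀ b → X b → a ⊥° b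

    _⊗°_ : ∀ {ε ε′} → Pred (Weighted ε) 0ℓ → Pred (Weighted ε′) 0ℓ →
           Pred (Weighted pos) 0ℓ
    (X ⊗° Y) a = ∃₂ λ t p → ∃₂ λ u q →
                 X (t , p) × Y (u , q) × a ≡ (⟪ t , u ⟫ , p + q)

    ↓°_ : ∀ {ε} → Pred (Weighted ε) 0ℓ → Pred (Weighted pos) 0ℓ
    (↓° X) a = ∃₂ λ t p → X (t , p) × a ≡ (box⟪ t ⟫ , p)

    -- In the clauses for ⅋ and ↑, ‖A^⊥ ⊗ B^⊥‖° and ‖↓ A^⊥‖° are unfolded one step.
    ‖_‖°≤ : ∀ {m ε} (A : MAL ε) → size A ≤ m → Pred (Weighted ε) 0ℓ
    ‖ var X ‖°≤  _       = ρ° X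
    ‖ A ⊗ B ‖°≤  (s≤s h) = ‖ A ‖°≤ (m+n≤o⇒m≤o (size A) h)
                           ⊗° ‖ B ‖°≤ (m+n≤o⇒n≤o (size A) h)
    ‖ ↓ A ‖°≤    (s≤s h) = ↓° ‖ A ‖°≤ h
    ‖ var⊥ X ‖°≤ _       = ρ° X ^⊥°
    ‖ A ⅋ B ‖°≤  (s≤s h) =
      (‖ A ᗮ ‖°≤ (subst (_≤ _) (sym (size-ᗮ A)) (m+n≤o⇒m≤o (size A) h))
       ⊗° ‖ B ᗮ ‖°≤ (subst (_≤ _) (sym (size-ᗮ B)) (m+n≤o⇒n≤o (size A) h))) ^⊥°
    ‖ ↑ A ‖°≤    (s≤s h) =
      (↓° ‖ A ᗮ ‖°≤ (subst (_≤ _) (sym (size-ᗮ A)) h)) ^⊥°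

    ‖_‖° : ∀ {ε} → MAL ε → Pred (Weighted ε) 0ℓ
    ‖ A ‖° = ‖ A ‖°≤ ≤-refl

    infix 4 _⊩°_

    -- ‖P‖° consists of weighted values; an arbitrary positive weighted term
    -- realizes P when it belongs to the biorthogonal.
    _⊩°_ : ∀ {ε} → Weighted ε → MAL ε → Set
    _⊩°_ {pos} a P = ((‖ P ‖° ^⊥°) ^⊥°) a
    _⊩°_ {neg} b N = ‖ N ‖° b

  induced-pole : Pole → Pred (Command [] × ℕ) 0ℓ
  induced-pole 𝕜• (c , p) = ∀ K → ‖𝒞[ p ]‖ K → c •[ K ] ∈𝕜
    where open Pole 𝕜•

  induced-valuation : (ℕ → ℕ → Terms pos) → ℕ → Pred (Weighted pos) 0ℓ
  induced-valuation ρ X (t , p) = ρ X p t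

{-# OPTIONS --safe #-}

-- The semantics of a formula only depends on the interpretation of whichever
-- of A and A^⊥ is positive.  Reading it off by structural recursion makes
-- duality and substitution transparent, and turns the forcing orthogonal into
-- the orthogonal of weighted terms: in both, a weight p meets a weight q along
-- the counters K ∈ ‖𝒞[p + q]‖.  The two interpretations of a MAL formula then
-- coincide by induction; for a positive formula the outer orthogonal of the
-- biorthogonal pairs its two arguments in the opposite order, which is absorbed
-- by the exchange property of the pole.
module Submission where

open import Defs
open import Level using (0ℓ)
open import Data.Fin using (Fin; zero; suc)
open import Data.List using ([])
open import Data.Nat using (ℕ; suc; _+_; _≤_; s≤s)
open import Data.Nat.Properties using (+-comm; ≤-refl; m+n≤o⇒m≤o; m+n≤o⇒n≤o)
open import Data.Product using (∃; _×_; _,_; proj₁; proj₂)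
open import Data.Vec using (Vec; []; _∷_; lookup)
open import Function using (_∘_; id; case_of_)
open import Function.Bundles using (_⇔_; mk⇔; module Equivalence)
open import Relation.Binary.PropositionalEquality
  using (_≡_; refl; cong₂; subst; sym; trans)
open import Relation.Unary using (Pred; _≐_)
open import Relation.Unary.Properties using (≐-refl; ≐-trans)

eval-substᴺ : ∀ {n m} (σ : Fin n → Num m) e e′ →
              (∀ i → eval (σ i) e ≡ lookup e′ i) →
              ∀ T → eval (substᴺ σ T) e ≡ eval T e′
eval-substᴺ σ e e′ eq (idx i) = eq i
eval-substᴺ σ e e′ eq (lit k) = refl
eval-substᴺ σ e e′ eq (T ⊹ U) = cong₂ _+_ (eval-substᴺ σ e e′ eq T) (eval-substᴺ σ e e′ eq U)

eval-lift : ∀ {n m} (σ : Fin n → Num m) e e′ →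
            (∀ i → eval (σ i) e ≡ lookup e′ i) →
            ∀ r i → eval (lift σ i) (r ∷ e) ≡ lookup (r ∷ e′) i
eval-lift σ e e′ eq r zero    = refl
-- Weakening is the substitution `idx ∘ suc`, so `eval-substᴺ` already shows that the new entry `r`
-- is ignored.
eval-lift σ e e′ eq r (suc i) = trans (eval-substᴺ _ (r ∷ e) e (λ _ → refl) (σ i)) (eq i)

module _ (Const : Pol → Set) where
  open Calculus Const

  ⊗ˢ-cong : ∀ {ε ε′} {X X′ : Terms ε} {Y Y′ : Terms ε′} →
            X ≐ X′ → Y ≐ Y′ → (X ⊗ˢ Y) ≐ (X′ ⊗ˢ Y′)
  ⊗ˢ-cong (f , f′) (g , g′) =
    (λ (t , u , x , y , eq) → t , u , f x , g y , eq) ,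
    (λ (t , u , x , y , eq) → t , u , f′ x , g′ y , eq)

  ↓ˢ-cong : ∀ {ε} {X X′ : Terms ε} → X ≐ X′ → (↓ˢ X) ≐ (↓ˢ X′)
  ↓ˢ-cong (f , f′) = (λ (t , x , eq) → t , f x , eq) , (λ (t , x , eq) → t , f′ x , eq)

  ∃-cong : {I : Set} {F G : I → Terms pos} → (∀ i → F i ≐ G i) →
           (λ t → ∃ λ i → F i t) ≐ (λ t → ∃ λ i → G i t)
  ∃-cong eq = (λ (i , x) → i , proj₁ (eq i) x) , (λ (i , x) → i , proj₂ (eq i) x)

  module Structural (𝕜• : Pole) (ρ : ℕ → ℕ → Terms pos) where
    open Pole 𝕜•
    open Countdown 𝕜• ρ
    open Quantitative (induced-pole 𝕜•) (induced-valuation ρ)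

    -- The polarity of the tested term is left free: a positive term may realize a negative formula,
    -- as happens for `p ⊩ᶠ P` with `P` positive.
    orth : ∀ {ε} → Terms pos → Terms ε
    orth X t = ∀ u → X u → ⟨ t ⊖∣ u ⟩ ∈𝕜

    orth-cong : ∀ {ε} {X X′ : Terms pos} → X ≐ X′ → orth {ε} X ≐ orth X′
    orth-cong (f , f′) = (λ o u → o u ∘ f′) , (λ o u → o u ∘ f)

    polarized : ∀ ε → Terms pos → Terms ε
    polarized pos X = X
    polarized neg X = orth X

    polarized-cong : ∀ ε {X X′ : Terms pos} → X ≐ X′ → polarized ε X ≐ polarized ε X′
    polarized-cong pos = id
    polarized-cong neg = orth-cong

    -- The interpretation of A if A is positive, of A^⊥ otherwise.
    ⟦_⟧ : ∀ {n ε} → Form n ε → Vec ℕ n → Terms pos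
    ⟦ var X T ⟧ e            = ρ X (eval T e)
    ⟦ 𝒞[ T ] ⟧ e             = ‖𝒞[ eval T e ]‖
    ⟦ _⊗_ {ε} {ε′} A B ⟧ e   = polarized ε (⟦ A ⟧ e) ⊗ˢ polarized ε′ (⟦ B ⟧ e)
    ⟦ ↓_ {ε} A ⟧ e           = ↓ˢ polarized ε (⟦ A ⟧ e)
    ⟦ ∃ι A ⟧ e               = λ t → ∃ λ r → ⟦ A ⟧ (r ∷ e) t
    ⟦ var⊥ X T ⟧ e           = ρ X (eval T e)
    ⟦ 𝒞⊥[ T ] ⟧ e            = ‖𝒞[ eval T e ]‖
    ⟦ _⅋_ {ε} {ε′} A B ⟧ e   = polarized (opp ε) (⟦ A ⟧ e) ⊗ˢ polarized (opp ε′) (⟦ B ⟧ e)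
    ⟦ ↑_ {ε} A ⟧ e           = ↓ˢ polarized (opp ε) (⟦ A ⟧ e)
    ⟦ ∀ι A ⟧ e               = λ t → ∃ λ r → ⟦ A ⟧ (r ∷ e) t
    ⟦ ⟨ T ≐ U ⟩ A ⟧ e        = λ t → eval T e ≡ eval U e × ⟦ A ⟧ e t

    -- `opp (opp ε)` reduces to `ε` only once `ε` is known. Splitting on the polarities makes both
    -- sides compute, with no transport along an involution law.
    ⊗ˢ-polarized-opp² : ∀ ε ε′ {X X′ Y Y′ : Terms pos} → X ≐ X′ → Y ≐ Y′ →
      (polarized (opp (opp ε)) X ⊗ˢ polarized (opp (opp ε′)) Y)
        ≐ (polarized ε X′ ⊗ˢ polarized ε′ Y′)
    ⊗ˢ-polarized-opp² pos pos x y = ⊗ˢ-cong x y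
    ⊗ˢ-polarized-opp² pos neg x y = ⊗ˢ-cong x (orth-cong y)
    ⊗ˢ-polarized-opp² neg pos x y = ⊗ˢ-cong (orth-cong x) y
    ⊗ˢ-polarized-opp² neg neg x y = ⊗ˢ-cong (orth-cong x) (orth-cong y)

    ↓ˢ-polarized-opp² : ∀ ε {X X′ : Terms pos} → X ≐ X′ →
      (↓ˢ polarized (opp (opp ε)) X) ≐ (↓ˢ polarized ε X′)
    ↓ˢ-polarized-opp² pos x = ↓ˢ-cong x
    ↓ˢ-polarized-opp² neg x = ↓ˢ-cong (orth-cong x)

    -- A formula and its dual share the same positive member. A double `opp` appears on the
    -- components only for `⊗` and `↓`, whose duals read their arguments dualized once more.
    ⟦dual⟧ : ∀ {n ε} (A : Form n ε) e → ⟦ dual A ⟧ e ≐ ⟦ A ⟧ e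
    ⟦dual⟧ (var X T) e     = ≐-refl
    ⟦dual⟧ 𝒞[ T ] e        = ≐-refl
    ⟦dual⟧ (A ⊗ B) e       = ⊗ˢ-polarized-opp² _ _ (⟦dual⟧ A e) (⟦dual⟧ B e)
    ⟦dual⟧ (↓ A) e         = ↓ˢ-polarized-opp² _ (⟦dual⟧ A e)
    ⟦dual⟧ (∃ι A) e        = ∃-cong λ r → ⟦dual⟧ A (r ∷ e)
    ⟦dual⟧ (var⊥ X T) e    = ≐-refl
    ⟦dual⟧ 𝒞⊥[ T ] e       = ≐-refl
    ⟦dual⟧ (A ⅋ B) e       = ⊗ˢ-cong (polarized-cong _ (⟦dual⟧ A e))
                                     (polarized-cong _ (⟦dual⟧ B e))
    ⟦dual⟧ (↑ A) e         = ↓ˢ-cong (polarized-cong _ (⟦dual⟧ A e))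
    ⟦dual⟧ (∀ι A) e        = ∃-cong λ r → ⟦dual⟧ A (r ∷ e)
    -- The guard is an existential over proofs of the equality.
    ⟦dual⟧ (⟨ T ≐ U ⟩ A) e = ∃-cong λ _ → ⟦dual⟧ A e

    -- Relating the environments pointwise lets the hypothesis pass under quantifiers, through
    -- `eval-lift`.
    ⟦substᶠ⟧ : ∀ {n m ε} (A : Form n ε) (σ : Fin n → Num m) e e′ →
               (∀ i → eval (σ i) e ≡ lookup e′ i) → ⟦ substᶠ σ A ⟧ e ≐ ⟦ A ⟧ e′
    ⟦substᶠ⟧ (var X T) σ e e′ eq rewrite eval-substᴺ σ e e′ eq T = ≐-refl
    ⟦substᶠ⟧ 𝒞[ T ] σ e e′ eq rewrite eval-substᴺ σ e e′ eq T = ≐-refl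
    ⟦substᶠ⟧ (A ⊗ B) σ e e′ eq = ⊗ˢ-cong (polarized-cong _ (⟦substᶠ⟧ A σ e e′ eq))
                                         (polarized-cong _ (⟦substᶠ⟧ B σ e e′ eq))
    ⟦substᶠ⟧ (↓ A) σ e e′ eq = ↓ˢ-cong (polarized-cong _ (⟦substᶠ⟧ A σ e e′ eq))
    ⟦substᶠ⟧ (∃ι A) σ e e′ eq = ∃-cong λ r →
      ⟦substᶠ⟧ A (lift σ) (r ∷ e) (r ∷ e′) (eval-lift σ e e′ eq r)
    ⟦substᶠ⟧ (var⊥ X T) σ e e′ eq rewrite eval-substᴺ σ e e′ eq T = ≐-refl
    ⟦substᶠ⟧ 𝒞⊥[ T ] σ e e′ eq rewrite eval-substᴺ σ e e′ eq T = ≐-refl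
    ⟦substᶠ⟧ (A ⅋ B) σ e e′ eq = ⊗ˢ-cong (polarized-cong _ (⟦substᶠ⟧ A σ e e′ eq))
                                         (polarized-cong _ (⟦substᶠ⟧ B σ e e′ eq))
    ⟦substᶠ⟧ (↑ A) σ e e′ eq = ↓ˢ-cong (polarized-cong _ (⟦substᶠ⟧ A σ e e′ eq))
    ⟦substᶠ⟧ (∀ι A) σ e e′ eq = ∃-cong λ r →
      ⟦substᶠ⟧ A (lift σ) (r ∷ e) (r ∷ e′) (eval-lift σ e e′ eq r)
    ⟦substᶠ⟧ (⟨ T ≐ U ⟩ A) σ e e′ eq
      rewrite eval-substᴺ σ e e′ eq T | eval-substᴺ σ e e′ eq U =
      ∃-cong λ _ → ⟦substᶠ⟧ A σ e e′ eq

    ⟦·⟧ : ∀ {n ε} (Z : Predicate ε) (T : Num n) e → ⟦ Z · T ⟧ e ≐ ⟦ Z ⟧ (eval T e ∷ [])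
    ⟦·⟧ Z T e = ⟦substᶠ⟧ Z (λ _ → T) e (eval T e ∷ []) λ { zero → refl }

    mutual
      -- The recursion is on the bound `m`: it drops at every connective and is kept by the detour
      -- of `‖‖≤≐` through `dual N`, which `⟦dual⟧` then undoes.
      ‖‖⁺≤≐ : ∀ {n m} (P : Form n pos) (h : sizeᶠ P ≤ m) e → ‖ P ‖⁺≤ h e ≐ ⟦ P ⟧ e
      ‖‖⁺≤≐ (var X T) h e = ≐-refl
      ‖‖⁺≤≐ 𝒞[ T ] h e = ≐-refl
      ‖‖⁺≤≐ (A ⊗ B) (s≤s h) e = ⊗ˢ-cong (‖‖≤≐ A (m+n≤o⇒m≤o (sizeᶠ A) h) e)
                                       (‖‖≤≐ B (m+n≤o⇒n≤o (sizeᶠ A) h) e)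
      ‖‖⁺≤≐ (↓ A) (s≤s h) e = ↓ˢ-cong (‖‖≤≐ A h e)
      ‖‖⁺≤≐ (∃ι A) (s≤s h) e = ∃-cong λ r → ‖‖⁺≤≐ A h (r ∷ e)
      ‖‖⁺≤≐ (⟨ T ≐ U ⟩ A) (s≤s h) e = ∃-cong λ _ → ‖‖⁺≤≐ A h e

      ‖‖≤≐ : ∀ {n m ε} (A : Form n ε) (h : sizeᶠ A ≤ m) e →
             ‖ A ‖≤ h e ≐ polarized ε (⟦ A ⟧ e)
      ‖‖≤≐ {ε = pos} P h e = ‖‖⁺≤≐ P h e
      ‖‖≤≐ {ε = neg} N h e = orth-cong
        (≐-trans (‖‖⁺≤≐ (dual N) (subst (_≤ _) (sym (size-dual N)) h) e) (⟦dual⟧ N e))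

    ⊩•-· : ∀ {ε} (N : Predicate neg) p →
           (λ (t : Term [] ε) → t ⊩• (N · lit p)) ≐ orth (⟦ N ⟧ (p ∷ []))
    ⊩•-· N p = orth-cong (≐-trans (‖‖⁺≤≐ (dual (N · lit p)) ≤-refl [])
      (≐-trans (⟦dual⟧ (N · lit p) []) (⟦·⟧ N (lit p) [])))

    -- The bridge between the two semantics: the argument of a predicate becomes a weight.
    weighted : ∀ {ε} → Predicate ε → Pred (Weighted ε) 0ℓ
    weighted {ε} Z (t , p) = polarized ε (⟦ Z ⟧ (p ∷ [])) t

    ⊗°-cong : ∀ {ε ε′} {X X′ : Pred (Weighted ε) 0ℓ} {Y Y′ : Pred (Weighted ε′) 0ℓ} →
              X ≐ X′ → Y ≐ Y′ → (X ⊗° Y) ≐ (X′ ⊗° Y′)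
    ⊗°-cong (f , f′) (g , g′) =
      (λ (t , p , u , q , x , y , eq) → t , p , u , q , f x , g y , eq) ,
      (λ (t , p , u , q , x , y , eq) → t , p , u , q , f′ x , g′ y , eq)

    ↓°-cong : ∀ {ε} {X X′ : Pred (Weighted ε) 0ℓ} → X ≐ X′ → (↓° X) ≐ (↓° X′)
    ↓°-cong (f , f′) =
      (λ (t , p , x , eq) → t , p , f x , eq) , (λ (t , p , x , eq) → t , p , f′ x , eq)

    ^⊥°-cong : ∀ {ε} {X X′ : Pred (Weighted ε) 0ℓ} → X ≐ X′ → (X ^⊥°) ≐ (X′ ^⊥°)
    ^⊥°-cong {pos} (f , f′) = (λ o a → o a ∘ f′) , (λ o a → o a ∘ f)
    ^⊥°-cong {neg} (f , f′) = (λ o a → o a ∘ f′) , (λ o a → o a ∘ f)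

    weighted-split : ∀ {ε ε′} (Y : Predicate ε) (Z : Predicate ε′) →
                     weighted (split Y Z) ≐ (weighted Y ⊗° weighted Z)
    weighted-split {ε} {ε′} Y Z =
      -- Matching the guard with `refl` turns `r` into `p + q`, the weight of a pair in `⊗°`; the
      -- two quantified numbers are the weights of its components.
      (λ { (p , q , refl , t , u , y , z , refl) →
           t , p , u , q , proj₁ (at-p p q) y , proj₁ (at-q p q) z , refl }) ,
      (λ { (t , p , u , q , y , z , refl) →
           p , q , refl , t , u , proj₂ (at-p p q) y , proj₂ (at-q p q) z , refl })
      where
      at-p : ∀ p q {r} → polarized ε (⟦ Y · idx (suc zero) ⟧ (q ∷ p ∷ r ∷ []))
                         ≐ polarized ε (⟦ Y ⟧ (p ∷ []))
      at-p p q = polarized-cong ε (⟦·⟧ Y (idx (suc zero)) _)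
      at-q : ∀ p q {r} → polarized ε′ (⟦ Z · idx zero ⟧ (q ∷ p ∷ r ∷ []))
                         ≐ polarized ε′ (⟦ Z ⟧ (q ∷ []))
      at-q p q = polarized-cong ε′ (⟦·⟧ Z (idx zero) _)

    weighted-↓ : ∀ {ε} (Z : Predicate ε) → weighted (↓ Z) ≐ (↓° weighted Z)
    weighted-↓ Z = (λ { (t , z , refl) → t , _ , z , refl }) ,
                   (λ { (t , p , z , refl) → t , z , refl })

    -- The tests are pairs of an argument and a counter. `⊸` dualizes `Z` and the positive reading
    -- of `⅋` dualizes it back, hence the double `opp`.
    ⟦overline⟧ : ∀ {ε} (Z : Predicate ε) p → ⟦ overline Z ⟧ (p ∷ []) ≐
      (λ s → ∃ λ r → (polarized ε (⟦ Z ⟧ (r ∷ [])) ⊗ˢ ‖𝒞[ p + r ]‖) s)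
    ⟦overline⟧ {ε} Z p = ∃-cong λ r → ⊗ˢ-polarized-opp² ε pos
      (≐-trans (⟦dual⟧ (Z · idx zero) (r ∷ p ∷ [])) (⟦·⟧ Z (idx zero) (r ∷ p ∷ [])))
      ≐-refl

    -- Currying: testing against a pair `(u , K)` is testing against `u`, then against every counter
    -- `K` allowed by `induced-pole` at the total weight.
    orth-overline : ∀ {ε} (Z : Predicate ε) →
      (λ (t , p) → orth (⟦ overline Z ⟧ (p ∷ [])) t) ≐ (weighted Z ^⊥°)
    -- Here `u` is the positive side, so the commands agree on the nose, but `⊥°` adds its weight
    -- first: `r + p` instead of `p + r`.
    orth-overline {pos} Z =
      (λ { {t , p} o (u , r) z K k → o _ (proj₂ (⟦overline⟧ Z p)
             (r , u , K , z , subst (λ n → ‖𝒞[ n ]‖ K) (+-comm r p) k , refl)) }) ,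
      (λ { {t , p} o _ x → case proj₁ (⟦overline⟧ Z p) x of λ
           { (r , u , K , z , k , refl) →
             o (u , r) z K (subst (λ n → ‖𝒞[ n ]‖ K) (+-comm p r) k) } })
    -- Here `t` is the positive side: the weights are in order, and it is the two terms that need
    -- swapping.
    orth-overline {neg} Z =
      (λ { {t , p} o (u , r) z K k → Equivalence.to exchange
             (o _ (proj₂ (⟦overline⟧ Z p) (r , u , K , z , k , refl))) }) ,
      (λ { {t , p} o _ x → case proj₁ (⟦overline⟧ Z p) x of λ
           { (r , u , K , z , k , refl) → Equivalence.from exchange (o (u , r) z K k) } })

    -- A record, so that Z and X can be inferred from the type.
    record _Represents_ {ε} (Z : Predicate ε) (X : Pred (Weighted ε) 0ℓ) : Set where
      constructor represents
      field weighted≐ : weighted Z ≐ X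
    open _Represents_

    infix 4 _Represents_

    split-represents : ∀ {ε ε′} {Y : Predicate ε} {Z : Predicate ε′} {X X′} →
                       Y Represents X → Z Represents X′ → split Y Z Represents X ⊗° X′
    split-represents {Y = Y} {Z} (represents y) (represents z) =
      represents (≐-trans (weighted-split Y Z) (⊗°-cong y z))

    ↓-represents : ∀ {ε} {Z : Predicate ε} {X} → Z Represents X → ↓ Z Represents ↓° X
    ↓-represents {Z = Z} (represents z) = represents (≐-trans (weighted-↓ Z) (↓°-cong z))

    -- Restricted to positive `Z`: `weighted (overline Z)` consists of negative terms, whereas the
    -- orthogonal of a negative set consists of positive ones.
    overline-represents : ∀ {Z : Predicate pos} {X} →
                          Z Represents X → overline Z Represents X ^⊥°
    overline-represents {Z} (represents z) =
      represents (≐-trans (orth-overline Z) (^⊥°-cong z))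

    -- Translation and interpretation recur on the same bound with the same proofs, so they unfold
    -- in lockstep, including at `A ᗮ`.
    star≤-represents : ∀ {m ε} (A : MAL ε) (h : size A ≤ m) →
                       star≤ A h Represents ‖ A ‖°≤ h
    star≤-represents (var X)  h       = represents ≐-refl
    star≤-represents (A ⊗ B)  (s≤s h) =
      split-represents (star≤-represents A _) (star≤-represents B _)
    star≤-represents (↓ A)    (s≤s h) = ↓-represents (star≤-represents A h)
    star≤-represents (var⊥ X) h       = overline-represents {var X (idx zero)} (represents ≐-refl)
    star≤-represents (A ⅋ B)  (s≤s h) = overline-represents
      (split-represents (star≤-represents (A ᗮ) _) (star≤-represents (B ᗮ) _))
    star≤-represents (↑ A)    (s≤s h) =
      overline-represents (↓-represents (star≤-represents (A ᗮ) _))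

    ⊩ᶠ⇔⊩° : ∀ {ε} (C : MAL ε) t p → (t ⊩• (p ⊩ᶠ C)) ⇔ ((t , p) ⊩° C)
    ⊩ᶠ⇔⊩° {pos} C t p = mk⇔ (proj₁ biorth ∘ proj₁ real) (proj₂ real ∘ proj₂ biorth)
      where
      real = ⊩•-· (overline (overline (C *))) p
      -- The inner orthogonal is a represented negative predicate; the outer one tests the positive
      -- `t` against it, which is the case of `orth-overline` using `exchange`.
      biorth = ≐-trans (orth-overline (overline (C *)))
        (^⊥°-cong (weighted≐ (overline-represents (star≤-represents C ≤-refl))))
    ⊩ᶠ⇔⊩° {neg} C t p = mk⇔ (proj₁ star ∘ proj₁ real) (proj₂ real ∘ proj₂ star)
      where
      real = ⊩•-· (C *) p
      star = weighted≐ (star≤-represents C ≤-refl)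

theorem90 : (Const : Pol → Set) → let open Calculus Const in
            (𝕜• : Pole) (𝒟 : PositiveDomain 𝕜•) (ρ• : Valuation 𝕜• 𝒟) →
            let open Valuation ρ•
                open Countdown 𝕜• ⟦_⟧
                open Quantitative (induced-pole 𝕜•) (induced-valuation ⟦_⟧) in
            ∀ {ε} (C : MAL ε) (t : Term [] ε) (p : ℕ) →
            (t ⊩• (p ⊩ᶠ C)) ⇔ ((t , p) ⊩° C)
theorem90 Const 𝕜• 𝒟 ρ• = Structural.⊩ᶠ⇔⊩° Const 𝕜• (Calculus.Valuation.⟦_⟧ ρ•)
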